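{- Let $(M,\in)$ be a countable model of ZFA. Let $\Gamma$ be its membership graph, ignoring multiple edges but keeping loops: the vertex set of $\Gamma$ is $M$, and for (not necessarily distinct) $x,y\in M$, $x$ is adjacent to $y$ if and only if $M\models x\in y$ or $M\models y\in x$ (so $x$ has a loop if and only if $M\models x\in x$). Then $\Gamma$ is isomorphic to the random loopy graph.
   Context: ZFA denotes the first-order theory obtained from ZFC (all objects being sets) by deleting the Axiom of Foundation and replacing it by the Anti-Foundation Axiom AFA. AFA states that every flat system of equations has a unique solution. A flat system of equations consists of a set $X$ of indeterminates, a set $A$ of sets called atoms (disjoint from $X$), and, for each $x\in X$, an equation $x=S_x$ with $S_x\subseteq X\cup A$ (the family $(S_x)_{x\in X}$ being itself a set). A solution is an assignment of sets to the indeterminates making all equations true, i.e. a function $s$ with domain $X$ such that $s(x)=\{s(y):y\in S_x\cap X\}\cup(S_x\cap A)$ for all $x\in X$. A loopy graph is an undirected graph without multiple edges in which loops are allowed, i.e. a set with a symmetric (not necessarily irreflexive) binary adjacency relation. The random loopy graph is the countable loopy graph obtained, up to isomorphism, with probability $1$ when edges (including loop edges) on a countably infinite vertex set are chosen independently with probability $1/2$ from all pairs of not necessarily distinct vertices. It is characterised, up to isomorphism, as the countable loopy graph such that, for any two finite disjoint sets $U$ and $V$ of vertices, there are vertices $z_1$ and $z_2$, where $z_1$ has no loop and $z_2$ has a loop, each joined to all vertices in $U$ and to no vertex in $V$. (Equivalently, it is the Fraïssé limit of the class of finite loopy graphs.) -}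

module Defs where

open import Data.Empty using (⊥)
open import Data.Fin using (Fin)
open import Data.List using (List)
open import Data.List.Relation.Binary.Disjoint.Propositional using (Disjoint)
open import Data.List.Relation.Unary.All using (All)
open import Data.Nat using (ℕ; suc)
open import Data.Product using (_×_; ∃; ∃!; ∃-syntax)
open import Data.Sum using (_⊎_; swap)
open import Data.Vec using (Vec; _∷_; lookup)
open import Function.Bundles using (_↣_; _↔_; _⇔_; Inverse)
open import Relation.Binary.Definitions using (Symmetric)
open import Relation.Binary.PropositionalEquality using (_≡_)
open import Relation.Nullary using (¬_)

-- At most countable, so finite sets are included.
Countable : Set → Set
Countable A = A ↣ ℕ

-- First-order formulas in the language {∈} with equality, whose free
-- variables are de Bruijn indices below n.
data Formula (n : ℕ) : Set where
  _∈′_ _≐′_      : Fin n → Fin n → Formula n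
  ⊥′             : Formula n
  _⇒′_ _∧′_ _∨′_ : Formula n → Formula n → Formula n
  ∀′_ ∃′_        : Formula (suc n) → Formula n

module SetTheory {M : Set} (_∈_ : M → M → Set) where

  infix 4 _∉_ _⟨_⟩≔_

  _∉_ : M → M → Set
  x ∉ y = ¬ (x ∈ y)

  Sat : ∀ {n} → Vec M n → Formula n → Set
  Sat ρ (i ∈′ j) = lookup ρ i ∈ lookup ρ j
  Sat ρ (i ≐′ j) = lookup ρ i ≡ lookup ρ j
  Sat ρ ⊥′       = ⊥
  Sat ρ (φ ⇒′ ψ) = Sat ρ φ → Sat ρ ψ
  Sat ρ (φ ∧′ ψ) = Sat ρ φ × Sat ρ ψ
  Sat ρ (φ ∨′ ψ) = Sat ρ φ ⊎ Sat ρ ψ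
  Sat ρ (∀′ φ)   = (x : M) → Sat (x ∷ ρ) φ
  Sat ρ (∃′ φ)   = ∃[ x ] Sat (x ∷ ρ) φ

  -- p = {a, b}
  IsPair : M → M → M → Set
  IsPair p a b = ∀ z → z ∈ p ⇔ (z ≡ a ⊎ z ≡ b)

  -- p = {{a}, {a, b}}
  IsOrderedPair : M → M → M → Set
  IsOrderedPair p a b = ∀ z → z ∈ p ⇔ (IsPair z a a ⊎ IsPair z a b)

  -- f(x) = y, for f a set of ordered pairs
  _⟨_⟩≔_ : M → M → M → Set
  f ⟨ x ⟩≔ y = ∃[ p ] (p ∈ f × IsOrderedPair p x y)

  -- A function is exactly its graph: f has no elements other than the
  -- pairs (x, f(x)) with x ∈ X.
  IsFunctionOn : M → M → Set
  IsFunctionOn f X =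
    (∀ p → p ∈ f → ∃[ x ] ∃[ y ] (x ∈ X × IsOrderedPair p x y)) ×
    (∀ x → x ∈ X → ∃! _≡_ λ y → f ⟨ x ⟩≔ y)

  -- S is the family (Sₓ) for x ∈ X.
  IsFlatSystem : (X A S : M) → Set
  IsFlatSystem X A S =
    (∀ x → x ∈ X → x ∉ A) ×
    IsFunctionOn S X ×
    (∀ x Sₓ → S ⟨ x ⟩≔ Sₓ → ∀ z → z ∈ Sₓ → z ∈ X ⊎ z ∈ A)

  -- s(x) = {s(y) : y ∈ Sₓ ∩ X} ∪ (Sₓ ∩ A) for all x ∈ X
  IsSolution : (X A S s : M) → Set
  IsSolution X A S s =
    IsFunctionOn s X ×
    (∀ x Sₓ sx → x ∈ X → S ⟨ x ⟩≔ Sₓ → s ⟨ x ⟩≔ sx →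
      ∀ z → z ∈ sx ⇔
        ((∃[ y ] (y ∈ Sₓ × y ∈ X × s ⟨ y ⟩≔ z)) ⊎ (z ∈ Sₓ × z ∈ A)))

  -- Each field is the Tarskian unfolding of an axiom.  The two schemas
  -- range over syntactic formulas with parameters ρ; quantifying over
  -- arbitrary Agda predicates instead would give a second-order theory.
  record IsModelOfZFA : Set where
    field
      extensionality : ∀ x y → (∀ z → z ∈ x ⇔ z ∈ y) → x ≡ y

      pairing : ∀ a b → ∃[ p ] IsPair p a b

      union : ∀ a → ∃[ u ] ∀ x → x ∈ u ⇔ (∃[ y ] (x ∈ y × y ∈ a))

      powerSet : ∀ a → ∃[ p ] ∀ x → x ∈ p ⇔ (∀ z → z ∈ x → z ∈ a)

      infinity : ∃[ i ]
        ((∃[ e ] (e ∈ i × (∀ z → z ∉ e))) ×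
         (∀ x → x ∈ i →
           ∃[ y ] (y ∈ i × (∀ z → z ∈ y ⇔ (z ∈ x ⊎ z ≡ x)))))

      separation : ∀ {n} (φ : Formula (suc n)) (ρ : Vec M n) (a : M) →
        ∃[ b ] ∀ x → x ∈ b ⇔ (x ∈ a × Sat (x ∷ ρ) φ)

      replacement : ∀ {n} (φ : Formula (suc (suc n))) (ρ : Vec M n) (a : M) →
        (∀ x → x ∈ a → ∀ y z →
          Sat (x ∷ y ∷ ρ) φ → Sat (x ∷ z ∷ ρ) φ → y ≡ z) →
        ∃[ b ] ∀ y → y ∈ b ⇔ (∃[ x ] (x ∈ a × Sat (x ∷ y ∷ ρ) φ))

      choice : ∀ a → (∀ x → x ∈ a → ∃[ z ] z ∈ x) →
        ∃[ f ] (IsFunctionOn f a × (∀ x y → x ∈ a → f ⟨ x ⟩≔ y → y ∈ x))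

      antiFoundation : ∀ X A S → IsFlatSystem X A S →
        ∃! _≡_ λ s → IsSolution X A S s

open SetTheory public using (IsModelOfZFA)

record LoopyGraph : Set₁ where
  field
    Vertex : Set
    _∼_    : Vertex → Vertex → Set
    ∼-sym  : Symmetric _∼_

record _≅_ (G H : LoopyGraph) : Set where
  private
    module G = LoopyGraph G
    module H = LoopyGraph H
  field
    vertices  : G.Vertex ↔ H.Vertex
    adjacency : ∀ x y →
      (x G.∼ y) ⇔ (Inverse.to vertices x H.∼ Inverse.to vertices y)

-- The characterisation of the random loopy graph among loopy graphs; it
-- determines the graph up to isomorphism.  Vertices z₁ and z₂ are not
-- required to lie outside U and V.
record IsRandomLoopyGraph (G : LoopyGraph) : Set where
  open LoopyGraph G
  field
    countable : Countable Vertex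
    extension : (U V : List Vertex) → Disjoint U V →
      (∃[ z₁ ] (¬ (z₁ ∼ z₁) × All (z₁ ∼_) U × All (λ v → ¬ (z₁ ∼ v)) V)) ×
      (∃[ z₂ ] (z₂ ∼ z₂     × All (z₂ ∼_) U × All (λ v → ¬ (z₂ ∼ v)) V))

membershipGraph : {M : Set} → (M → M → Set) → LoopyGraph
membershipGraph {M} _∈_ = record
  { Vertex = M
  ; _∼_    = λ x y → (x ∈ y) ⊎ (y ∈ x)
  ; ∼-sym  = swap
  }

{-# OPTIONS --safe #-}
-- The extension property comes from the Russell set w = {x ∈ b : x ∉ x},
-- which belongs neither to b nor to itself.  Choose w outside V, outside the
-- members of U and V, and outside the members of the members of V.  Then
-- z₁ = U ∪ {w} has no loop, and the z₂ = {z₂} ∪ U ∪ {w} given by AFA has one;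
-- as w ∈ zᵢ, neither zᵢ ∈ v nor zᵢ = v is possible for v ∈ V.
-- Isomorphism with any other random loopy graph is a back-and-forth argument.
module Submission where

open import Defs
open import Axiom.ExcludedMiddle using (ExcludedMiddle)
open import Data.Empty using (⊥-elim)
open import Data.Fin using (zero)
open import Data.List using (List; []; _∷_; _++_; map; filter)
open import Data.List.Membership.Propositional using () renaming (_∈_ to _∈ₗ_; _∉_ to _∉ₗ_)
open import Data.List.Membership.Propositional.Properties
  using (∈-++⁺ˡ; ∈-++⁺ʳ; ∈-map⁺; ∈-map⁻; ∈-filter⁺; ∈-filter⁻)
open import Data.List.Relation.Binary.Disjoint.Propositional using (Disjoint)
open import Data.List.Relation.Unary.All as All using (All; _∷_)
open import Data.List.Relation.Unary.Any using (here; there)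
open import Data.Nat using (ℕ; zero; suc; _⊔_; _≤′_; ≤′-refl; ≤′-step)
open import Data.Nat.Properties using (m≤m⊔n; m≤n⊔m; ≤⇒≤′)
open import Data.Product using (_×_; _,_; ∃-syntax; proj₁; proj₂; swap)
open import Data.Sum using (_⊎_; inj₁; inj₂; [_,_]′)
import Data.Sum as Sum
open import Data.Vec using ([])
open import Function using (id; _∘_)
open import Function.Bundles using (_⇔_; mk⇔; mk↔ₛ′; Equivalence; Injection)
open import Function.Properties.Equivalence using (⇔-isEquivalence)
open import Level using (0ℓ)
open import Relation.Binary.Structures using (IsEquivalence)
open import Relation.Binary.PropositionalEquality using (_≡_; _≢_; refl; sym; trans; subst)
open import Relation.Nullary using (¬_; Dec; yes; no; ¬?)

open Equivalence using (to; from)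
open IsEquivalence (⇔-isEquivalence {0ℓ}) using ()
  renaming (sym to ⇔-sym; trans to ⇔-trans)

-- Finite sets and fresh sets inside a model of ZFA.

module Sets {M : Set} (_∈_ : M → M → Set) (zfa : IsModelOfZFA _∈_) where
  open SetTheory _∈_ hiding (IsModelOfZFA)
  open IsModelOfZFA zfa

  binaryUnion : ∀ a b → ∃[ u ] ∀ x → x ∈ u ⇔ (x ∈ a ⊎ x ∈ b)
  binaryUnion a b with pairing a b
  ... | p , p≐ with union p
  ... | u , u≐ = u , λ x → mk⇔ (split x ∘ to (u≐ x)) (from (u≐ x) ∘ join x)
    where
    split : ∀ x → ∃[ y ] (x ∈ y × y ∈ p) → x ∈ a ⊎ x ∈ b
    split x (y , x∈y , y∈p) with to (p≐ y) y∈p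
    ... | inj₁ refl = inj₁ x∈y
    ... | inj₂ refl = inj₂ x∈y
    join : ∀ x → x ∈ a ⊎ x ∈ b → ∃[ y ] (x ∈ y × y ∈ p)
    join x (inj₁ x∈a) = a , x∈a , from (p≐ a) (inj₁ refl)
    join x (inj₂ x∈b) = b , x∈b , from (p≐ b) (inj₂ refl)

  adjoin : ∀ x a → ∃[ b ] ∀ y → y ∈ b ⇔ (y ≡ x ⊎ y ∈ a)
  adjoin x a with pairing x x
  ... | p , p≐ with binaryUnion p a
  ... | b , b≐ = b , λ y → mk⇔
    (Sum.map₁ ([ id , id ]′ ∘ to (p≐ y)) ∘ to (b≐ y))
    (from (b≐ y) ∘ Sum.map₁ (from (p≐ y) ∘ inj₁))

  finiteSet : (l : List M) → ∃[ a ] ∀ x → x ∈ a ⇔ x ∈ₗ l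
  -- The empty set is taken from the axiom of infinity.
  finiteSet [] with infinity
  ... | _ , (e , _ , e-empty) , _ = e , λ x → mk⇔ (⊥-elim ∘ e-empty x) (λ ())
  finiteSet (x ∷ l) with finiteSet l
  ... | a , a≐ with adjoin x a
  ... | b , b≐ = b , λ y → mk⇔
    ([ here , there ∘ to (a≐ y) ]′ ∘ to (b≐ y))
    λ { (here y≡x)  → from (b≐ y) (inj₁ y≡x)
      ; (there y∈l) → from (b≐ y) (inj₂ (from (a≐ y) y∈l)) }

  -- If w ∈ w, the defining condition of w gives w ∉ w; so w ∉ w outright, and w ∈ b would then put
  -- w into itself. No appeal to Foundation is made.
  russell : ∀ b → ∃[ w ] (w ∉ w × w ∉ b)
  russell b with separation ((zero ∈′ zero) ⇒′ ⊥′) [] b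
  ... | w , w≐ = w , w∉w , λ w∈b → w∉w (from (w≐ w) (w∈b , w∉w))
    where
    w∉w : w ∉ w
    w∉w w∈w = proj₂ (to (w≐ w) w∈w) w∈w

  -- For a set z with w ∈ z, the three clauses exclude v = w, v = z and z ∈ v respectively.
  Fresh : M → M → Set
  Fresh w v = w ≢ v × w ∉ v × (∀ y → y ∈ v → w ∉ y)

  -- A Russell set for c = a ∪ ⋃a ∪ ⋃⋃a, where a is the set of entries of `l`: each of the three
  -- layers yields one clause of `Fresh`.
  fresh : (l : List M) → ∃[ w ] (w ∉ w × (∀ v → v ∈ₗ l → Fresh w v))
  fresh l with finiteSet l
  ... | a , a≐ with union a
  ... | ⋃a , ⋃a≐ with union ⋃a
  ... | ⋃⋃a , ⋃⋃a≐ with binaryUnion ⋃a ⋃⋃a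
  ... | b , b≐ with binaryUnion a b
  ... | c , c≐ with russell c
  ... | w , w∉w , w∉c = w , w∉w , λ v v∈l →
    let v∈a = from (a≐ v) v∈l in
    (λ { refl → w∉c (from (c≐ w) (inj₁ v∈a)) }) ,
    (λ w∈v → w∉c (from (c≐ w) (inj₂ (from (b≐ w)
      (inj₁ (from (⋃a≐ w) (v , w∈v , v∈a))))))) ,
    (λ y y∈v w∈y → w∉c (from (c≐ w) (inj₂ (from (b≐ w)
      (inj₂ (from (⋃⋃a≐ w) (y , w∈y , from (⋃a≐ y) (v , y∈v , v∈a))))))))

  -- Kuratowski pairs, one-point functions and a one-equation flat system.

  IsPair-unique : ∀ {p q a b} → IsPair p a b → IsPair q a b → p ≡ q
  IsPair-unique p≐ q≐ = extensionality _ _ λ z → ⇔-trans (p≐ z) (⇔-sym (q≐ z))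

  IsPair-injective : ∀ {p a b c d} → IsPair p a b → IsPair p c d →
    (a ≡ c × b ≡ d) ⊎ (a ≡ d × b ≡ c)
  IsPair-injective {p} {a} {b} {c} {d} p≐ab p≐cd
    with to (p≐cd a) (from (p≐ab a) (inj₁ refl))
       | to (p≐cd b) (from (p≐ab b) (inj₂ refl))
       | to (p≐ab c) (from (p≐cd c) (inj₁ refl))
       | to (p≐ab d) (from (p≐cd d) (inj₂ refl))
  ... | inj₁ a≡c  | inj₂ b≡d  | _ | _ = inj₁ (a≡c , b≡d)
  ... | inj₂ a≡d  | inj₁ b≡c  | _ | _ = inj₂ (a≡d , b≡c)
  -- In the remaining cases a and b coincide, and the reverse inclusion forces c and d to coincide
  -- with them.
  ... | inj₁ refl | inj₁ refl | _ | inj₁ refl = inj₁ (refl , refl)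
  ... | inj₁ refl | inj₁ refl | _ | inj₂ refl = inj₁ (refl , refl)
  ... | inj₂ refl | inj₂ refl | inj₁ refl | _ = inj₁ (refl , refl)
  ... | inj₂ refl | inj₂ refl | inj₂ refl | _ = inj₁ (refl , refl)

  orderedPair : ∀ a b → ∃[ p ] IsOrderedPair p a b
  orderedPair a b with pairing a a | pairing a b
  ... | s , s≐ | t , t≐ with pairing s t
  ... | p , p≐ = p , λ z → mk⇔
    (λ z∈p → Sum.map (λ { refl → s≐ }) (λ { refl → t≐ }) (to (p≐ z) z∈p))
    (from (p≐ z) ∘ Sum.map (λ z≐ → IsPair-unique z≐ s≐) (λ z≐ → IsPair-unique z≐ t≐))

  -- Names the components {a} and {a, b}, so that `IsPair-injective` applies to the outer pair as
  -- well as to the inner ones.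
  IsOrderedPair⇒IsPair : ∀ {p a b s t} → IsOrderedPair p a b →
    IsPair s a a → IsPair t a b → IsPair p s t
  IsOrderedPair⇒IsPair p≐ s≐ t≐ z = ⇔-trans (p≐ z) (mk⇔
    (Sum.map (λ z≐ → IsPair-unique z≐ s≐) (λ z≐ → IsPair-unique z≐ t≐))
    (Sum.map (λ { refl → s≐ }) (λ { refl → t≐ })))

  IsOrderedPair-injective : ∀ {p a b c d} →
    IsOrderedPair p a b → IsOrderedPair p c d → a ≡ c × b ≡ d
  IsOrderedPair-injective {p} {a} {b} {c} {d} p≐ab p≐cd
    with pairing a a | pairing a b | pairing c c | pairing c d
  ... | s , s≐ | t , t≐ | s′ , s′≐ | t′ , t′≐
    with IsPair-injective (IsOrderedPair⇒IsPair p≐ab s≐ t≐)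
                          (IsOrderedPair⇒IsPair p≐cd s′≐ t′≐)
  ... | inj₁ (refl , refl) with IsPair-injective s≐ s′≐ | IsPair-injective t≐ t′≐
  ...   | _               | inj₁ eqs           = eqs
  ...   | inj₁ (refl , _) | inj₂ (refl , refl) = refl , refl
  ...   | inj₂ (refl , _) | inj₂ (refl , refl) = refl , refl
  -- The crossed case {a} = {c, d} and {a, b} = {c}: all four sets coincide.
  IsOrderedPair-injective _ _
      | s , s≐ | t , t≐ | s′ , s′≐ | t′ , t′≐
      | inj₂ (refl , refl) with IsPair-injective s≐ t′≐ | IsPair-injective t≐ s′≐
  ...   | inj₁ (refl , refl) | inj₁ (_ , refl) = refl , refl
  ...   | inj₁ (refl , refl) | inj₂ (_ , refl) = refl , refl
  ...   | inj₂ (refl , refl) | inj₁ (_ , refl) = refl , refl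
  ...   | inj₂ (refl , refl) | inj₂ (_ , refl) = refl , refl

  -- Encodes a family with one equation as the set {(x, y)}. The last clause recovers the right-hand
  -- side from the graph, as the flatness condition of AFA requires.
  singletonFunction : ∀ {X x} → IsPair X x x → ∀ y →
    ∃[ f ] (IsFunctionOn f X × f ⟨ x ⟩≔ y ×
            (∀ x′ y′ → f ⟨ x′ ⟩≔ y′ → x ≡ x′ × y ≡ y′))
  singletonFunction {X} {x} X≐ y with orderedPair x y
  ... | p , p≐ with pairing p p
  ... | f , f≐ = f , (isGraph , functional) , fx≔y , inverse
    where
    fx≔y : f ⟨ x ⟩≔ y
    fx≔y = p , from (f≐ p) (inj₁ refl) , p≐
    inverse : ∀ x′ y′ → f ⟨ x′ ⟩≔ y′ → x ≡ x′ × y ≡ y′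
    inverse x′ y′ (q , q∈f , q≐) with [ id , id ]′ (to (f≐ q) q∈f)
    ... | refl = IsOrderedPair-injective p≐ q≐
    isGraph : ∀ q → q ∈ f → ∃[ x′ ] ∃[ y′ ] (x′ ∈ X × IsOrderedPair q x′ y′)
    isGraph q q∈f with [ id , id ]′ (to (f≐ q) q∈f)
    ... | refl = x , y , from (X≐ x) (inj₁ refl) , p≐
    functional : ∀ x′ → x′ ∈ X → _
    functional x′ x′∈X with [ id , id ]′ (to (X≐ x′) x′∈X)
    ... | refl = y , fx≔y , λ {y′} fx≔y′ → proj₂ (inverse x y′ fx≔y′)

  -- AFA applied to the single equation x = {x} ∪ a.
  selfAdjoin : ∀ a → ∃[ z ] ∀ y → y ∈ z ⇔ (y ≡ z ⊎ y ∈ a)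
  selfAdjoin a with russell a
  -- AFA demands indeterminates disjoint from the atoms, here the elements of `a`; a Russell set for
  -- `a` serves as the indeterminate.
  ... | x , _ , x∉a with pairing x x | adjoin x a
  ... | X , X≐ | Sₓ , Sₓ≐ with singletonFunction X≐ Sₓ
  ... | S , S-function , Sx≔Sₓ , S-inverse
    with antiFoundation X a S (disjoint , S-function , flat)
    where
    disjoint : ∀ y → y ∈ X → y ∉ a
    disjoint y y∈X y∈a with [ id , id ]′ (to (X≐ y) y∈X)
    ... | refl = x∉a y∈a
    flat : ∀ y Sᵧ → S ⟨ y ⟩≔ Sᵧ → ∀ z → z ∈ Sᵧ → z ∈ X ⊎ z ∈ a
    flat y Sᵧ Sy≔ z z∈Sᵧ with S-inverse y Sᵧ Sy≔
    ... | refl , refl = Sum.map₁ (from (X≐ z) ∘ inj₁) (to (Sₓ≐ z) z∈Sᵧ)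
  ... | s , ((_ , s-functional) , s-solves) , _ with s-functional x (from (X≐ x) (inj₁ refl))
  ... | z , sx≔z , z-unique = z , λ y → mk⇔ (forth y ∘ to (equation y)) (from (equation y) ∘ back y)
    where
    x∈X : x ∈ X
    x∈X = from (X≐ x) (inj₁ refl)
    equation = s-solves x Sₓ z x∈X Sx≔Sₓ sx≔z
    forth : ∀ y → ∃[ t ] (t ∈ Sₓ × t ∈ X × s ⟨ t ⟩≔ y) ⊎ (y ∈ Sₓ × y ∈ a) → y ≡ z ⊎ y ∈ a
    forth y (inj₁ (t , _ , t∈X , st≔y)) with [ id , id ]′ (to (X≐ t) t∈X)
    ... | refl = inj₁ (sym (z-unique st≔y))
    forth y (inj₂ (_ , y∈a)) = inj₂ y∈a
    back : ∀ y → y ≡ z ⊎ y ∈ a → ∃[ t ] (t ∈ Sₓ × t ∈ X × s ⟨ t ⟩≔ y) ⊎ (y ∈ Sₓ × y ∈ a)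
    back y (inj₁ refl) = inj₁ (x , from (Sₓ≐ x) (inj₁ refl) , x∈X , sx≔z)
    back y (inj₂ y∈a)  = inj₂ (from (Sₓ≐ y) (inj₂ y∈a) , y∈a)

  -- The extension property of the membership graph.

  open LoopyGraph (membershipGraph _∈_) using (_∼_)

  -- Allowing y ≡ z in the bound on z lets one argument serve both the loopless and the looped
  -- witness.
  nonadjacent : ∀ {U : List M} {w z v} → w ∈ z →
    (∀ y → y ∈ z → y ≡ z ⊎ y ∈ₗ w ∷ U) →
    v ∉ₗ U → Fresh w v → ¬ (z ∼ v)
  nonadjacent w∈z z⊆ v∉U (_ , _ , w∉∈v) (inj₁ z∈v) = w∉∈v _ z∈v w∈z
  nonadjacent w∈z z⊆ v∉U (w≢v , w∉v , _) (inj₂ v∈z) with z⊆ _ v∈z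
  ... | inj₁ refl         = w∉v w∈z
  ... | inj₂ (here v≡w)   = w≢v (sym v≡w)
  ... | inj₂ (there v∈U)  = v∉U v∈U

  extension : (U V : List M) → Disjoint U V →
    (∃[ z₁ ] (¬ (z₁ ∼ z₁) × All (z₁ ∼_) U × All (λ v → ¬ (z₁ ∼ v)) V)) ×
    (∃[ z₂ ] (z₂ ∼ z₂     × All (z₂ ∼_) U × All (λ v → ¬ (z₂ ∼ v)) V))
  -- Freshness over `U` is for looplessness: z₁ ∈ z₁ would mean z₁ = w, against w ∉ w, or z₁ ∈ U,
  -- placing w in a member of `U`.
  extension U V U#V with fresh (U ++ V)
  ... | w , w∉w , w-fresh with finiteSet (w ∷ U)
  ... | z₁ , z₁≐ with selfAdjoin z₁
  ... | z₂ , z₂≐ =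
    (z₁ , [ z₁∉z₁ , z₁∉z₁ ]′ ,
     All.tabulate (λ u∈U → inj₂ (from (z₁≐ _) (there u∈U))) ,
     All.tabulate (λ v∈V → nonadjacent w∈z₁ (λ y → inj₂ ∘ to (z₁≐ y))
       (λ v∈U → U#V (v∈U , v∈V)) (w-fresh _ (∈-++⁺ʳ U v∈V)))) ,
    (z₂ , inj₁ (from (z₂≐ z₂) (inj₁ refl)) ,
     All.tabulate (λ u∈U → inj₂ (from (z₂≐ _) (inj₂ (from (z₁≐ _) (there u∈U))))) ,
     All.tabulate (λ v∈V → nonadjacent (from (z₂≐ w) (inj₂ w∈z₁))
       (λ y → Sum.map₂ (to (z₁≐ y)) ∘ to (z₂≐ y))
       (λ v∈U → U#V (v∈U , v∈V)) (w-fresh _ (∈-++⁺ʳ U v∈V))))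
    where
    w∈z₁ : w ∈ z₁
    w∈z₁ = from (z₁≐ w) (here refl)
    z₁∉z₁ : z₁ ∉ z₁
    z₁∉z₁ z₁∈z₁ with to (z₁≐ z₁) z₁∈z₁
    ... | here refl   = w∉w w∈z₁
    ... | there z₁∈U  = proj₁ (proj₂ (w-fresh z₁ (∈-++⁺ˡ z₁∈U))) w∈z₁

-- Prescribed adjacencies in a random loopy graph.

module Realisation (em : ExcludedMiddle 0ℓ) {G : LoopyGraph} (random : IsRandomLoopyGraph G) where
  open LoopyGraph G
  open IsRandomLoopyGraph random

  -- A looped vertex adjacent to nothing in F lies outside F.
  outsider : (F : List Vertex) → ∃[ p ] (p ∉ₗ F × All (λ v → ¬ (p ∼ v)) F)
  outsider F with proj₂ (extension [] F λ ())
  ... | p , p∼p , _ , p≁F = p , (λ p∈F → All.lookup p≁F p∈F p∼p) , p≁F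

  -- The new vertex is kept outside F by making it adjacent to an outsider.
  realise : (F : List Vertex) (P : Vertex → Set) (loop : Set) →
    ∃[ z ] (z ∉ₗ F × (∀ v → v ∈ₗ F → z ∼ v ⇔ P v) × (z ∼ z ⇔ loop))
  realise F P loop with outsider F
  ... | p , p∉F , p≁F = choose em
    where
    P? : ∀ v → Dec (P v)
    P? v = em
    U V : List Vertex
    U = p ∷ filter P? F
    V = filter (¬? ∘ P?) F
    U#V : Disjoint U V
    U#V (here refl , v∈V) = p∉F (proj₁ (∈-filter⁻ (¬? ∘ P?) {xs = F} v∈V))
    U#V (there v∈U , v∈V) =
      proj₂ (∈-filter⁻ (¬? ∘ P?) {xs = F} v∈V) (proj₂ (∈-filter⁻ P? {xs = F} v∈U))
    avoids : ∀ {z} → All (z ∼_) U → z ∉ₗ F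
    avoids (z∼p ∷ _) z∈F = All.lookup p≁F z∈F (∼-sym z∼p)
    exact : ∀ {z} → All (z ∼_) U → All (λ v → ¬ (z ∼ v)) V → ∀ v → v ∈ₗ F → z ∼ v ⇔ P v
    exact z∼U z≁V v v∈F with P? v
    ... | yes Pv = mk⇔ (λ _ → Pv) (λ _ → All.lookup z∼U (there (∈-filter⁺ P? v∈F Pv)))
    ... | no ¬Pv = mk⇔
      (λ z∼v → ⊥-elim (All.lookup z≁V (∈-filter⁺ (¬? ∘ P?) v∈F ¬Pv) z∼v))
      (λ Pv → ⊥-elim (¬Pv Pv))
    choose : Dec loop → ∃[ z ] (z ∉ₗ F × (∀ v → v ∈ₗ F → z ∼ v ⇔ P v) × (z ∼ z ⇔ loop))
    choose (yes l) with proj₂ (extension U V U#V)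
    ... | z , z∼z , z∼U , z≁V =
      z , avoids z∼U , exact z∼U z≁V , mk⇔ (λ _ → l) (λ _ → z∼z)
    choose (no ¬l) with proj₁ (extension U V U#V)
    ... | z , z≁z , z∼U , z≁V =
      z , avoids z∼U , exact z∼U z≁V , mk⇔ (⊥-elim ∘ z≁z) (⊥-elim ∘ ¬l)

-- Finite partial isomorphisms and their one-point extensions.

-- The equivalence of equalities makes the list single-valued and injective at once; the adjacency
-- clause for a pair with itself preserves loops.
record PartialIso (G H : LoopyGraph) : Set where
  private
    module G = LoopyGraph G
    module H = LoopyGraph H
  field
    graph    : List (G.Vertex × H.Vertex)
    coherent : ∀ {a b a′ b′} → (a , b) ∈ₗ graph → (a′ , b′) ∈ₗ graph →
               (a ≡ a′ ⇔ b ≡ b′) × (a G.∼ a′ ⇔ b H.∼ b′)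

open PartialIso

_⊑_ : ∀ {G H} → PartialIso G H → PartialIso G H → Set
p ⊑ q = ∀ {ab} → ab ∈ₗ graph p → ab ∈ₗ graph q

flip : ∀ {G H} → PartialIso G H → PartialIso H G
flip p .graph = map swap (graph p)
flip p .coherent ab∈ ab′∈ with ∈-map⁻ swap ab∈ | ∈-map⁻ swap ab′∈
... | _ , ba∈ , refl | _ , ba′∈ , refl with coherent p ba∈ ba′∈
... | eq , adj = ⇔-sym eq , ⇔-sym adj

-- The image of a new vertex must lie outside the range, copy the adjacencies of `a` to the domain,
-- and have a loop exactly when `a` has one.
extend : ExcludedMiddle 0ℓ → ∀ {G H} → IsRandomLoopyGraph H →
  (p : PartialIso G H) (a : LoopyGraph.Vertex G) →
  ∃[ q ] (p ⊑ q × ∃[ b ] (a , b) ∈ₗ graph q)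
extend em {G} {H} random p a with em {∃[ b ] (a , b) ∈ₗ graph p}
... | yes a∈dom = p , id , a∈dom
... | no a∉dom with Realisation.realise em random (map proj₂ (graph p))
                      (λ b → ∃[ c ] ((c , b) ∈ₗ graph p × LoopyGraph._∼_ G a c))
                      (LoopyGraph._∼_ G a a)
... | z , z∉ran , z∼ , z∼z = q , there , z , here refl
  where
  module G = LoopyGraph G
  module H = LoopyGraph H
  adjacent : ∀ {c b} → (c , b) ∈ₗ graph p → a G.∼ c ⇔ z H.∼ b
  adjacent {c} {b} cb∈ = mk⇔ (λ a∼c → from z∼b (c , cb∈ , a∼c)) (partner ∘ to z∼b)
    where
    z∼b = z∼ b (∈-map⁺ proj₂ cb∈)
    -- The prescribed adjacency asks for some preimage of `b`; coherence makes that preimage unique,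
    -- so it is `c`.
    partner : ∃[ c′ ] ((c′ , b) ∈ₗ graph p × a G.∼ c′) → a G.∼ c
    partner (c′ , c′b∈ , a∼c′) =
      subst (a G.∼_) (from (proj₁ (coherent p c′b∈ cb∈)) refl) a∼c′
  q : PartialIso G H
  q .graph = (a , z) ∷ graph p
  q .coherent (here refl) (here refl) = mk⇔ (λ _ → refl) (λ _ → refl) , ⇔-sym z∼z
  q .coherent (here refl) (there cb∈) =
    mk⇔ (λ { refl → ⊥-elim (a∉dom (_ , cb∈)) })
        (λ { refl → ⊥-elim (z∉ran (∈-map⁺ proj₂ cb∈)) }) ,
    adjacent cb∈
  q .coherent (there cb∈) (here refl) =
    mk⇔ (λ { refl → ⊥-elim (a∉dom (_ , cb∈)) })
        (λ { refl → ⊥-elim (z∉ran (∈-map⁺ proj₂ cb∈)) }) ,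
    mk⇔ (H.∼-sym ∘ to (adjacent cb∈) ∘ G.∼-sym)
        (G.∼-sym ∘ from (adjacent cb∈) ∘ H.∼-sym)
  q .coherent (there ab∈) (there ab′∈) = coherent p ab∈ ab′∈

-- The back-and-forth construction.

module BackAndForth (em : ExcludedMiddle 0ℓ) {G H : LoopyGraph}
  (G-random : IsRandomLoopyGraph G) (H-random : IsRandomLoopyGraph H) where
  private
    module G = LoopyGraph G
    module H = LoopyGraph H
    module RG = IsRandomLoopyGraph G-random
    module RH = IsRandomLoopyGraph H-random
  open Injection using (injective) renaming (to to index)

  Covers : ℕ → PartialIso G H → Set
  Covers n p =
    (∀ a → index RG.countable a ≡ n → ∃[ b ] (a , b) ∈ₗ graph p) ×
    (∀ b → index RH.countable b ≡ n → ∃[ a ] (a , b) ∈ₗ graph p)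

  coverDomain : ∀ n (p : PartialIso G H) →
    ∃[ q ] (p ⊑ q × (∀ a → index RG.countable a ≡ n → ∃[ b ] (a , b) ∈ₗ graph q))
  coverDomain n p with em {∃[ a ] index RG.countable a ≡ n}
  ... | no none = p , id , λ a eq → ⊥-elim (none (a , eq))
  ... | yes (a , eq) with extend em H-random p a
  ... | q , p⊑q , b , ab∈q = q , p⊑q , λ a′ eq′ →
    b , subst (λ x → (x , b) ∈ₗ graph q) (injective RG.countable (trans eq (sym eq′))) ab∈q

  coverRange : ∀ n (p : PartialIso G H) →
    ∃[ q ] (p ⊑ q × (∀ b → index RH.countable b ≡ n → ∃[ a ] (a , b) ∈ₗ graph q))
  coverRange n p with em {∃[ b ] index RH.countable b ≡ n}
  ... | no none = p , id , λ b eq → ⊥-elim (none (b , eq))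
  -- The back step is the forth step for the inverse partial isomorphism.
  ... | yes (b , eq) with extend em G-random (flip p) b
  ... | q , p⊑q , a , ba∈q = flip q , ∈-map⁺ swap ∘ p⊑q ∘ ∈-map⁺ swap , λ b′ eq′ →
    a , subst (λ y → (a , y) ∈ₗ graph (flip q)) (injective RH.countable (trans eq (sym eq′)))
          (∈-map⁺ swap ba∈q)

  step : ∀ n (p : PartialIso G H) → ∃[ q ] (p ⊑ q × Covers n q)
  step n p with coverDomain n p
  ... | q , p⊑q , dom with coverRange n q
  ... | r , q⊑r , ran = r , q⊑r ∘ p⊑q ,
    (λ a eq → let b , ab∈q = dom a eq in b , q⊑r ab∈q) , ran

  -- The vertices of index n on both sides are covered from stage n + 1 onwards.
  stage : ℕ → PartialIso G H
  stage zero    = record { graph = [] ; coherent = λ () }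
  stage (suc n) = proj₁ (step n (stage n))

  stage-mono : ∀ {m n} → m ≤′ n → stage m ⊑ stage n
  stage-mono ≤′-refl           = id
  stage-mono (≤′-step {n} m≤n) = proj₁ (proj₂ (step n (stage n))) ∘ stage-mono m≤n

  _↦_ : G.Vertex → H.Vertex → Set
  a ↦ b = ∃[ n ] (a , b) ∈ₗ graph (stage n)

  -- Two pairs of the limit relation occur together at the later of their stages, so coherence
  -- passes to the union.
  ↦-coherent : ∀ {a b a′ b′} → a ↦ b → a′ ↦ b′ →
    (a ≡ a′ ⇔ b ≡ b′) × (a G.∼ a′ ⇔ b H.∼ b′)
  ↦-coherent (m , ab∈) (n , ab′∈) = coherent (stage (m ⊔ n))
    (stage-mono (≤⇒≤′ (m≤m⊔n m n)) ab∈) (stage-mono (≤⇒≤′ (m≤n⊔m m n)) ab′∈)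

  image : ∀ a → ∃[ b ] (a ↦ b)
  image a =
    let n = index RG.countable a
        b , ab∈ = proj₁ (proj₂ (proj₂ (step n (stage n)))) a refl
    in b , suc n , ab∈

  preimage : ∀ b → ∃[ a ] (a ↦ b)
  preimage b =
    let n = index RH.countable b
        a , ab∈ = proj₂ (proj₂ (proj₂ (step n (stage n)))) b refl
    in a , suc n , ab∈

  isomorphic : G ≅ H
  isomorphic = record
    { vertices  = mk↔ₛ′ (proj₁ ∘ image) (proj₁ ∘ preimage)
        -- Coherence identifies two partners of the same vertex, which makes `image` and `preimage`
        -- mutually inverse.
        (λ b → let a , a↦b = preimage b in to (proj₁ (↦-coherent (proj₂ (image a)) a↦b)) refl)
        (λ a → let b , a↦b = image a in from (proj₁ (↦-coherent (proj₂ (preimage b)) a↦b)) refl)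
    ; adjacency = λ x y → proj₂ (↦-coherent (proj₂ (image x)) (proj₂ (image y)))
    }

theorem2 : ExcludedMiddle 0ℓ →
    (M : Set) (_∈_ : M → M → Set) →
    Countable M → IsModelOfZFA _∈_ →
    IsRandomLoopyGraph (membershipGraph _∈_) ×
    ((R : LoopyGraph) → IsRandomLoopyGraph R → membershipGraph _∈_ ≅ R)
theorem2 em M _∈_ countable zfa =
  random , λ R R-random → BackAndForth.isomorphic em random R-random
  where
  random : IsRandomLoopyGraph (membershipGraph _∈_)
  random = record { countable = countable ; extension = Sets.extension _∈_ zfa }
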